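{- Let $r\ge3$ be an odd integer and $a=r+1$. The subtraction game $\mathcal{S}(1,a,3a+r)$ is ultimately periodic with period $4a$ and nim-sequence $\big((01)^{a/2-1}\,2\big)^2\big((01)^{a/2}\,2\big)^2$. Moreover, if $r=3$ then the subtraction set is non-expandable; otherwise the subtraction set has expansion $\{1,a,4a-1\}\cup\{4a+1,5a\}^{*(4a)}$ (equivalently $\{1,a,3a+r\}\cup\{3a+r+2,4a+r+1\}^{*(4a)}$).
   Context: For a finite set $S$ of positive integers, the subtraction game $\mathcal{S}(S)$ is played on a single pile: two players alternately remove $s\in S$ coins (at most the pile size); the last mover wins. The nim-value is $\mathcal{G}(n)=\operatorname{mex}\{\mathcal{G}(n-s): s\in S, s\le n\}$. Words of single digits are written by juxtaposition, and $x^m$ denotes $m$-fold repetition of the block $x$. "The game is ultimately periodic with period $p$ and nim-sequence $W$" ($W$ a word of length $p$) means $p$ is the least positive integer with $\mathcal{G}(n+p)=\mathcal{G}(n)$ for all sufficiently large $n$, and there is $n_0\ge0$ such that $\mathcal{G}(n_0+j)$ is the $((j\bmod p)+1)$-st letter of $W$ for all $j\ge0$. The expansion of $S$ is $S^{ex}=\{s\ge1:\mathcal{G}(n+s)\ne\mathcal{G}(n)\ \forall n\ge0\}$; "has expansion $T$" means $S^{ex}=T$. For a set $X$ and $p\ge1$, $X^{*p}=\{x+mp:x\in X,m\ge0\}$. $S$ is non-expandable if $S^{ex}=S$ or $S^{ex}=S^{*p}$, $p$ the period. -}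

module Defs where

open import Data.Nat using (ℕ; zero; suc; _+_; _*_; _∸_; _≤_; _<_; _≟_; _≤ᵇ_)
open import Data.Bool using (Bool; true; false; if_then_else_)
open import Data.List using (List; []; _∷_; _++_; length; lookup; concatMap)
open import Data.List.Membership.Propositional using (_∈_)
open import Data.Fin using (Fin; toℕ)
open import Data.Product using (Σ; ∃; _×_; _,_)
open import Data.Sum using (_⊎_)
open import Relation.Nullary using (¬_; does)
open import Relation.Binary.PropositionalEquality using (_≡_; _≢_)
open import Function.Bundles using (_⇔_)

elemᵇ : ℕ → List ℕ → Bool
elemᵇ k []       = false
elemᵇ k (x ∷ xs) = if does (k ≟ x) then true else elemᵇ k xs

-- mex: least natural number not in the list.  Some k ≤ length L is
-- missing, so searching through length L + 1 candidates suffices.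
mexFrom : List ℕ → ℕ → ℕ → ℕ
mexFrom L k zero     = k
mexFrom L k (suc f)  = if elemᵇ k L then mexFrom L (suc k) f else k

mex : List ℕ → ℕ
mex L = mexFrom L 0 (suc (length L))

nthD : List ℕ → ℕ → ℕ
nthD []       _       = 0
nthD (x ∷ xs) zero    = x
nthD (x ∷ xs) (suc i) = nthD xs i

-- given prev = [G(n-1), ..., G(0)], the values G(n - s) for s ∈ S, 1 ≤ s ≤ n
options : List ℕ → ℕ → List ℕ → List ℕ
options S n prev =
  concatMap (λ s → if (1 ≤ᵇ s) Data.Bool.∧ (s ≤ᵇ n) then nthD prev (s ∸ 1) ∷ [] else []) S

-- grundyRev S n = [G(n-1), ..., G(1), G(0)]
grundyRev : List ℕ → ℕ → List ℕ
grundyRev S zero    = []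
grundyRev S (suc n) = mex (options S n (grundyRev S n)) ∷ grundyRev S n

G : List ℕ → ℕ → ℕ
G S n = mex (options S n (grundyRev S n))

IsPeriod : List ℕ → ℕ → Set
IsPeriod S p = ∃ λ N → ∀ n → N ≤ n → G S (n + p) ≡ G S n

IsLeastPeriod : List ℕ → ℕ → Set
IsLeastPeriod S p = (0 < p) × IsPeriod S p × (∀ q → 0 < q → IsPeriod S q → p ≤ q)

-- ultimately periodic with period p and nim-sequence W (W of length p):
-- some n0 with G(n0 + j) = the (j mod p)-th letter of W (0-based), written
-- here as j = q * p + i with i : Fin (length W).
UltPeriodic : List ℕ → ℕ → List ℕ → Set
UltPeriodic S p W =
  IsLeastPeriod S p × length W ≡ p ×
  (∃ λ n0 → ∀ (q : ℕ) (i : Fin (length W)) → G S (n0 + (q * length W + toℕ i)) ≡ lookup W i)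

rep : ℕ → List ℕ → List ℕ
rep zero    x = []
rep (suc m) x = x ++ rep m x

InExpansion : List ℕ → ℕ → Set
InExpansion S s = (1 ≤ s) × (∀ n → G S (n + s) ≢ G S n)

HasExpansion : List ℕ → (ℕ → Set) → Set
HasExpansion S T = ∀ s → InExpansion S s ⇔ T s

Star : List ℕ → ℕ → ℕ → Set
Star X p s = Σ ℕ λ x → x ∈ X × ∃ λ m → s ≡ x + m * p

NonExpandable : List ℕ → ℕ → Set
NonExpandable S p = HasExpansion S (λ s → s ∈ S) ⊎ HasExpansion S (Star S p)

{-# OPTIONS --safe #-}

-- Shift the nim-sequence 4a + 1 places to the right and fill the gap with a value that never
-- influences a mex; the result E obeys the same three-term recurrence from the start.  Cut E
-- into blocks of length a.  For even a ≥ 6 every block has at most four irregular letters and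
-- then alternates 0 1 0 1 …, so it is an inflated copy of a block for a = 6, and the sequence of
-- blocks itself cycles with period four from block 9 on.  Hence the recurrence, the
-- non-coincidences g (n + s) ≠ g n for s in the expansion, the coincidences for every other s,
-- and the failure of smaller periods are all decided on a finite table of block and letter
-- classes.  For a = 4 the blocks are too short for the pattern and the sequence differs
-- (the value 3 occurs at 15); there a table of E itself does the same job.

module Submission where

open import Defs
open import Data.Bool using (true; false; if_then_else_; _∧_)
open import Data.Bool.Properties using (T-≡)
open import Data.Empty using (⊥-elim)
open import Data.Fin as Fin using (Fin; toℕ; #_)
import Data.Fin.Properties as Finₚ
open import Data.List using (List; []; _∷_; _++_; length; lookup)
open import Data.List.Membership.Propositional using (_∈_; _∉_)
open import Data.List.Membership.Propositional.Properties using (∈-concatMap⁺)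
open import Data.List.Properties using (++-assoc)
open import Data.List.Relation.Unary.Any as Any using (here; there; index)
open import Data.List.Relation.Unary.Any.Properties using (lookup-index)
open import Data.Maybe as Maybe using (Maybe; just; nothing)
open import Data.Nat hiding (compare; equal; less; greater)
open import Data.Nat.Divisibility using (_∣_; divides)
open import Data.Nat.DivMod using (_divMod_; result; m*n/n≡m)
open import Data.Nat.Properties
open import Data.Nat.Tactic.RingSolver using (solve-∀)
open import Data.List.Membership.DecPropositional _≟_ using (_∈?_)
open import Data.Product using (∃; ∃₂; _×_; _,_; proj₁; proj₂)
open import Data.Sum using (_⊎_; inj₁; inj₂)
open import Data.Unit using (⊤; tt)
open import Data.Vec as Vec using (Vec; []; _∷_)
open import Function using (_∘_; Equivalence; mk⇔)
open import Relation.Nullary using (¬_; yes; no)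
open import Relation.Nullary.Decidable using (True; toWitness; ¬?; _×-dec_; _⊎-dec_; _→-dec_)
open import Relation.Binary.PropositionalEquality

-- Minimal excludants.

elemᵇ⇒∈ : ∀ k L → elemᵇ k L ≡ true → k ∈ L
elemᵇ⇒∈ k (x ∷ L) eq with k ≡ᵇ x in k≡ᵇx
... | true  = here (≡ᵇ⇒≡ k x (Equivalence.from T-≡ k≡ᵇx))
... | false = there (elemᵇ⇒∈ k L eq)

∈⇒elemᵇ : ∀ {k L} → k ∈ L → elemᵇ k L ≡ true
∈⇒elemᵇ {k} {x ∷ L} (here k≡x) rewrite Equivalence.to T-≡ (≡⇒≡ᵇ k x k≡x) = refl
∈⇒elemᵇ {k} {x ∷ L} (there k∈L) with k ≡ᵇ x
... | true  = refl
... | false = ∈⇒elemᵇ k∈L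

-- A search that ends on an element of L never met a missing candidate and ran out of fuel, so all
-- its candidates lie in L.
mexFrom∈⇒all∈ : ∀ L k f → mexFrom L k f ∈ L → ∀ i → i < f → k + i ∈ L
mexFrom∈⇒all∈ L k (suc f) m∈L i i<f with elemᵇ k L in eq
mexFrom∈⇒all∈ L k (suc f) m∈L i i<f | false with () ← trans (sym eq) (∈⇒elemᵇ m∈L)
mexFrom∈⇒all∈ L k (suc f) m∈L zero i<f | true = subst (_∈ L) (sym (+-identityʳ k)) (elemᵇ⇒∈ k L eq)
mexFrom∈⇒all∈ L k (suc f) m∈L (suc i) (s≤s i<f) | true =
  subst (_∈ L) (sym (+-suc k i)) (mexFrom∈⇒all∈ L (suc k) f m∈L i i<f)

-- Otherwise all length L + 1 candidates would lie in L, and by the pigeonhole principle two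
-- different ones would share a position in L.
mex∉ : ∀ L → mex L ∉ L
mex∉ L mex∈L = Finₚ.<⇒≢ i<j (Finₚ.toℕ-injective same)
  where
  member : (i : Fin (suc (length L))) → toℕ i ∈ L
  member i = mexFrom∈⇒all∈ L 0 (suc (length L)) mex∈L (toℕ i) (Finₚ.toℕ<n i)
  clash = Finₚ.pigeonhole (n<1+n (length L)) (index ∘ member)
  i = proj₁ clash
  j = proj₁ (proj₂ clash)
  i<j = proj₁ (proj₂ (proj₂ clash))
  same : toℕ i ≡ toℕ j
  same = trans (lookup-index (member i))
    (trans (cong (lookup L) (proj₂ (proj₂ (proj₂ clash)))) (sym (lookup-index (member j))))

-- Options and nim-values of an arbitrary subtraction set.

module _ (S : List ℕ) where

  option : ℕ → ℕ → List ℕ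
  option n s = if (1 ≤ᵇ s) ∧ (s ≤ᵇ n) then nthD (grundyRev S n) (s ∸ 1) ∷ [] else []

  nthD-grundyRev : ∀ i n → nthD (grundyRev S (suc i + n)) i ≡ G S n
  nthD-grundyRev zero    n = refl
  nthD-grundyRev (suc i) n = nthD-grundyRev i n

  option-available : ∀ n s → 1 ≤ s → option (s + n) s ≡ G S n ∷ []
  option-available n (suc s) _ rewrite Equivalence.to T-≡ (≤⇒≤ᵇ (m≤m+n (suc s) n)) =
    cong (_∷ []) (nthD-grundyRev s n)

  option-unavailable : ∀ {n s} → n < s → option n s ≡ []
  option-unavailable {n} {suc s} n<s with suc s ≤ᵇ n in eq
  ... | false = refl
  ... | true  = ⊥-elim (<⇒≱ n<s (≤ᵇ⇒≤ (suc s) n (Equivalence.from T-≡ eq)))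

  -- `G S n` is an option of n + s, and a mex avoids its options. Hence every positive element of S
  -- belongs to the expansion.
  G≢option : ∀ {s} → s ∈ S → 1 ≤ s → ∀ n → G S (n + s) ≢ G S n
  G≢option {s} s∈S 1≤s n eq = mex∉ _ (subst (_∈ options S (n + s) (grundyRev S (n + s))) (sym eq)
    (∈-concatMap⁺ (option (n + s)) (Any.map f s∈S)))
    where
    f : ∀ {x} → s ≡ x → G S n ∈ option (n + s) x
    f refl rewrite +-comm n s | option-available n s 1≤s = here refl

-- Periods and words read along a sequence.

module _ (f : ℕ → ℕ) where

  Spells : ℕ → List ℕ → Set
  Spells n []      = ⊤
  Spells n (x ∷ w) = f n ≡ x × Spells (suc n) w

  Spells-lookup : ∀ {n} w → Spells n w → (i : Fin (length w)) → f (n + toℕ i) ≡ lookup w i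
  Spells-lookup {n} (x ∷ w) (eq , _)  Fin.zero    = trans (cong f (+-identityʳ n)) eq
  Spells-lookup {n} (x ∷ w) (_ , sw) (Fin.suc i) =
    trans (cong f (+-suc n (toℕ i))) (Spells-lookup w sw i)

  PeriodicFrom : ℕ → ℕ → Set
  PeriodicFrom n₀ p = ∀ n → f (p + (n₀ + n)) ≡ f (n₀ + n)

  periodic-multiple : ∀ {n₀ p} → PeriodicFrom n₀ p → ∀ q n → f (n₀ + (q * p + n)) ≡ f (n₀ + n)
  periodic-multiple per zero    n = refl
  periodic-multiple {n₀} {p} per (suc q) n =
    trans (cong f (rearrange n₀ p (q * p) n)) (trans (per (q * p + n)) (periodic-multiple per q n))
    where
    rearrange : ∀ n₀ p x n → n₀ + (p + x + n) ≡ p + (n₀ + (x + n))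
    rearrange = solve-∀

-- A smaller period need only be refuted at one place of the periodic part: moved on by N periods,
-- that place lies beyond any bound N from which the alleged period would hold.
ultPeriodic : ∀ S {f} → (∀ n → G S n ≡ f n) → ∀ n₀ p W → 0 < p → PeriodicFrom f n₀ p →
  length W ≡ p → Spells f n₀ W → (∀ q → 0 < q → q < p → ∃ λ n → f (n₀ + n + q) ≢ f (n₀ + n)) →
  UltPeriodic S p W
ultPeriodic S {f} G≗f n₀ _ W 0<p per refl spells aperiodic =
    (0<p , (n₀ , isPeriod) , least) , refl
  , (n₀ , λ q i → trans (G≗f _) (trans (periodic-multiple f per q (toℕ i)) (Spells-lookup f W spells i)))
  where
  p = length W
  isPeriod : ∀ n → n₀ ≤ n → G S (n + p) ≡ G S n
  isPeriod n n₀≤n = subst (λ m → G S (m + p) ≡ G S m) (m+[n∸m]≡n n₀≤n)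
    (trans (G≗f _) (trans (cong f (+-comm _ p)) (trans (per (n ∸ n₀)) (sym (G≗f _)))))
  rearrange : ∀ n₀ x n q → n₀ + (x + (n + q)) ≡ n₀ + (x + n) + q
  rearrange = solve-∀
  large : ∀ N n → N ≤ n₀ + (N * p + n)
  large N n = ≤-trans (m≤m*n N p {{>-nonZero 0<p}}) (≤-trans (m≤m+n (N * p) n) (m≤n+m _ n₀))
  least : ∀ q → 0 < q → IsPeriod S q → p ≤ q
  least q 0<q (N , perq) = ≮⇒≥ λ q<p → let n , differ = aperiodic q 0<q q<p in
    differ (begin
      f (n₀ + n + q)                ≡⟨ cong f (+-assoc n₀ n q) ⟩
      f (n₀ + (n + q))              ≡⟨ periodic-multiple f per N (n + q) ⟨
      f (n₀ + (N * p + (n + q)))    ≡⟨ cong f (rearrange n₀ (N * p) n q) ⟩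
      f (n₀ + (N * p + n) + q)      ≡⟨ G≗f _ ⟨
      G S (n₀ + (N * p + n) + q)    ≡⟨ perq _ (large N n) ⟩
      G S (n₀ + (N * p + n))        ≡⟨ G≗f _ ⟩
      f (n₀ + (N * p + n))          ≡⟨ periodic-multiple f per N n ⟩
      f (n₀ + n)                    ∎)
    where open ≡-Reasoning

-- The nim-sequence as runs of 01.

rep-snoc : ∀ m (x y : List ℕ) → x ++ (rep m x ++ y) ≡ rep m x ++ (x ++ y)
rep-snoc zero    x y = refl
rep-snoc (suc m) x y = begin
  x ++ ((x ++ rep m x) ++ y)  ≡⟨ cong (x ++_) (++-assoc x (rep m x) y) ⟩
  x ++ (x ++ (rep m x ++ y))  ≡⟨ cong (x ++_) (rep-snoc m x y) ⟩
  x ++ (rep m x ++ (x ++ y))  ≡⟨ ++-assoc x (rep m x) (x ++ y) ⟨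
  (x ++ rep m x) ++ (x ++ y)  ∎
  where open ≡-Reasoning

zeroOne : List ℕ
zeroOne = 0 ∷ 1 ∷ []

segment : ℕ → List ℕ
segment m = rep m zeroOne ++ (2 ∷ [])

nimSequence : ℕ → List ℕ
nimSequence b = rep 2 (segment (b ∸ 1)) ++ rep 2 (segment b)

-- Moving surplus copies of 01 behind the run lets segments of both lengths be written with runs of
-- one common length.
segment-split : ∀ m y → segment (1 + m) ++ y ≡ rep m zeroOne ++ (0 ∷ 1 ∷ 2 ∷ y)
segment-split m y = trans (++-assoc (rep (1 + m) zeroOne) (2 ∷ []) y) (rep-snoc m zeroOne (2 ∷ y))

segment-split² : ∀ m y → segment (2 + m) ++ y ≡ rep m zeroOne ++ (0 ∷ 1 ∷ 0 ∷ 1 ∷ 2 ∷ y)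
segment-split² m y = trans (segment-split (1 + m) y) (rep-snoc m zeroOne (0 ∷ 1 ∷ 2 ∷ y))

length-run : ∀ m (y : List ℕ) → length (rep m zeroOne ++ y) ≡ m * 2 + length y
length-run zero    y = refl
length-run (suc m) y = cong (λ x → suc (suc x)) (length-run m y)

-- The three-term recurrence for 1, a and 4a - 1.

cong₃ : ∀ {A : Set} (f : ℕ → ℕ → ℕ → A) {x x′ y y′ z z′} →
  x ≡ x′ → y ≡ y′ → z ≡ z′ → f x y z ≡ f x′ y′ z′
cong₃ f refl refl refl = refl

mex-drop₂ : ∀ x → mex (x ∷ []) ≡ mex (x ∷ 9 ∷ 9 ∷ [])
mex-drop₂ zero    = refl
mex-drop₂ (suc x) = refl

mex-drop₁ : ∀ x y → mex (x ∷ y ∷ []) ≡ mex (x ∷ y ∷ 9 ∷ [])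
mex-drop₁ 0             0             = refl
mex-drop₁ 0             1             = refl
mex-drop₁ 0             (suc (suc y)) = refl
mex-drop₁ 1             0             = refl
mex-drop₁ (suc (suc x)) 0             = refl
mex-drop₁ (suc x)       (suc y)       = refl

-- Opaque, so that comparing open terms does not unfold mex.
opaque
  mex₃ : ℕ → ℕ → ℕ → ℕ
  mex₃ x y z = mex (x ∷ y ∷ z ∷ [])

  mex≡mex₃ : ∀ x y z → mex (x ∷ y ∷ z ∷ []) ≡ mex₃ x y z
  mex≡mex₃ x y z = refl

+-suc-assoc : ∀ x y z → x + suc (y + z) ≡ x + suc y + z
+-suc-assoc = solve-∀

module Game (a ℓ : ℕ) (1≤a : 1 ≤ a) (1+ℓ≡4a : suc ℓ ≡ 4 * a) where

  S : List ℕ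
  S = 1 ∷ a ∷ ℓ ∷ []

  g : ℕ → ℕ
  g = G S

  a≤ℓ : a ≤ ℓ
  a≤ℓ = ≤-pred (subst (suc a ≤_) (sym 1+ℓ≡4a)
    (≤-trans (+-monoˡ-≤ a 1≤a) (+-monoʳ-≤ a (m≤m+n a (2 * a)))))

  -- 9 marks an unavailable option: no mex of three numbers depends on it.
  ext : ℕ → ℕ → ℕ
  ext zero    n       = g n
  ext (suc s) zero    = 9
  ext (suc s) (suc n) = ext s n

  ext-available : ∀ s n → ext s (s + n) ≡ g n
  ext-available zero    n = refl
  ext-available (suc s) n = ext-available s n

  ext-unavailable : ∀ {s n} → n < s → ext s n ≡ 9
  ext-unavailable {suc s} {zero}  _         = refl
  ext-unavailable {suc s} {suc n} (s≤s n<s) = ext-unavailable n<s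

  ext-+ : ∀ t s n → ext (t + s) (t + n) ≡ ext s n
  ext-+ zero    s n = refl
  ext-+ (suc t) s n = ext-+ t s n

  option-≤ : ∀ {s n} → s ≤ n → 1 ≤ s → option S n s ≡ g (n ∸ s) ∷ []
  option-≤ {s} {n} s≤n 1≤s =
    subst (λ m → option S m s ≡ g (n ∸ s) ∷ []) (m+[n∸m]≡n s≤n) (option-available S _ s 1≤s)

  ext-≤ : ∀ {s n} → s ≤ n → ext s n ≡ g (n ∸ s)
  ext-≤ {s} {n} s≤n = subst (λ m → ext s m ≡ g (n ∸ s)) (m+[n∸m]≡n s≤n) (ext-available s _)

  -- As 1 ≤ a ≤ ℓ, the options 1, a and ℓ become available in this order when n grows, which leaves
  -- few patterns of padding to compare.
  g-rec : ∀ n → g n ≡ mex (ext 1 n ∷ ext a n ∷ ext ℓ n ∷ [])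
  g-rec zero
    rewrite option-unavailable S {0} {a} 1≤a | option-unavailable S {0} {ℓ} (≤-trans 1≤a a≤ℓ)
          | ext-unavailable {a} {0} 1≤a | ext-unavailable {ℓ} {0} (≤-trans 1≤a a≤ℓ) = refl
  g-rec (suc n) with a ≤? suc n
  ... | no a≰n
    rewrite option-unavailable S (≰⇒> a≰n) | option-unavailable S (<-≤-trans (≰⇒> a≰n) a≤ℓ)
          | ext-unavailable (≰⇒> a≰n) | ext-unavailable (<-≤-trans (≰⇒> a≰n) a≤ℓ) = mex-drop₂ (g n)
  ... | yes a≤n with ℓ ≤? suc n
  ...   | no ℓ≰n
    rewrite option-unavailable S (≰⇒> ℓ≰n) | ext-unavailable (≰⇒> ℓ≰n)
          | option-≤ a≤n 1≤a | ext-≤ a≤n = mex-drop₁ (g n) (g (suc n ∸ a))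
  ...   | yes ℓ≤n
    rewrite option-≤ a≤n 1≤a | option-≤ ℓ≤n (≤-trans 1≤a a≤ℓ) | ext-≤ a≤n | ext-≤ ℓ≤n = refl

  -- E (4a + 1 + n) = g n.  With this shift the option n − ℓ of letter i of block k is letter
  -- i + 1 of block k − 4, and it leaves that block only for i = a − 1.
  E : ℕ → ℕ
  E = ext (suc (4 * a))

  E-shift : ∀ n → E (4 * a + suc n) ≡ g n
  E-shift n = trans (cong E (+-suc (4 * a) n)) (ext-available (suc (4 * a)) n)

  E-rec : ∀ y → E (4 * a + suc y) ≡ mex₃ (E (4 * a + y)) (E (3 * a + suc y)) (E (2 + y))
  E-rec y = trans (E-shift y) (trans (g-rec y) (trans (mex≡mex₃ _ _ _) (cong₃ mex₃
      (shift (4 * a) 1 (+-comm (4 * a) 1))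
      (trans (shift (suc (3 * a)) a (rearrange a)) (cong E (sym (+-suc (3 * a) y))))
      (shift 2 ℓ (cong suc 1+ℓ≡4a)))))
    where
    shift : ∀ t s → t + s ≡ suc (4 * a) → ext s y ≡ E (t + y)
    shift t s eq = trans (sym (ext-+ t s y)) (cong (λ x → ext x (t + y)) eq)
    rearrange : ∀ a → suc (3 * a) + a ≡ suc (4 * a)
    rearrange = solve-∀

-- Eventually cyclic classes of blocks and letters.

orbit : ∀ {A : Set} → (A → A) → A → ℕ → A
orbit f x zero    = x
orbit f x (suc n) = f (orbit f x n)

orbit-+ : ∀ {A : Set} (f : A → A) x m n → orbit f x (m + n) ≡ orbit f (orbit f x n) m
orbit-+ f x zero    n = refl
orbit-+ f x (suc m) n = cong f (orbit-+ f x m n)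

successor : ∀ {n} → Fin n → Maybe (Fin n)
successor {suc zero}    Fin.zero    = nothing
successor {suc (suc n)} Fin.zero    = just (Fin.suc Fin.zero)
successor               (Fin.suc i) = Maybe.map Fin.suc (successor i)

next : ∀ {n} → Fin n → Fin n → Fin n
next w i = Maybe.fromMaybe w (successor i)

-- class w runs through 0, 1, …, n once and then cycles through w, …, n.
class : ∀ {n} → Fin (suc n) → ℕ → Fin (suc n)
class w = orbit (next w) Fin.zero

-- The blocks of E for a = 6, N being the padding; for larger a the last two letters of a word are repeated
-- (see letter), and the last four words are repeated (see block).
words : Vec (Vec ℕ 6) 13
words = N ∷ N ∷ N ∷ N ∷ A ∷ B ∷ C ∷ D ∷ E ∷ B ∷ C ∷ D ∷ C ∷ []
  where
  N = 9 ∷ 9 ∷ 9 ∷ 9 ∷ 9 ∷ 9 ∷ []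
  A = 9 ∷ 0 ∷ 1 ∷ 0 ∷ 1 ∷ 0 ∷ []
  B = 1 ∷ 2 ∷ 0 ∷ 1 ∷ 0 ∷ 1 ∷ []
  C = 0 ∷ 1 ∷ 2 ∷ 0 ∷ 1 ∷ 0 ∷ []
  D = 1 ∷ 0 ∷ 1 ∷ 2 ∷ 0 ∷ 1 ∷ []
  E = 2 ∷ 3 ∷ 2 ∷ 0 ∷ 1 ∷ 0 ∷ []

word : Fin 13 → Fin 6 → ℕ
word κ l = Vec.lookup (Vec.lookup words κ) l

nextB : Fin 13 → Fin 13
nextB = next (# 9)

nextL : Fin 6 → Fin 6
nextL = next (# 4)

block : ℕ → Fin 13
block = class (# 9)

letter : ℕ → Fin 6
letter = class (# 4)

-- The recurrence on the finite table.

opaque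
  unfolding mex₃

  -- With κ the class of block k, the new letter lies in block k + 4 and its option ℓ in block k.
  -- The letter classes include the step from 5 back to 4, which settles the repeated part of every
  -- longer block.
  inner-ok : ∀ κ c → word (orbit nextB κ 4) (nextL c) ≡
    mex₃ (word (orbit nextB κ 4) c) (word (orbit nextB κ 3) (nextL c)) (word κ (nextL (nextL c)))
  inner-ok = toWitness {a? = Finₚ.all? λ κ → Finₚ.all? λ c → _ ≟ _} tt

  -- This is letter a - 1, whose option ℓ is carried to letter 0 of block k + 1.
  last-ok : ∀ κ → word (orbit nextB κ 4) (# 5) ≡
    mex₃ (word (orbit nextB κ 4) (# 4)) (word (orbit nextB κ 3) (# 5)) (word (nextB κ) (# 0))
  last-ok = toWitness {a? = Finₚ.all? λ κ → _ ≟ _} tt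

  -- Here option 1 is the last letter of the preceding block. The new letter lies in block k + 5
  -- rather than k + 4 because letter 0 of block 4 is still padding.
  first-ok : ∀ κ → word (orbit nextB κ 5) (# 0) ≡
    mex₃ (word (orbit nextB κ 4) (# 5)) (word (orbit nextB κ 4) (# 0)) (word (nextB κ) (# 1))
  first-ok = toWitness {a? = Finₚ.all? λ κ → _ ≟ _} tt

-- The blocks of E for even a ≥ 6.

module Inflated (a ℓ c : ℕ) (a≡ : a ≡ 6 + c * 2) (1+ℓ≡4a : suc ℓ ≡ 4 * a) where

  bounded : ∀ i {i<6 : True (i <? 6)} → i < a
  bounded i {i<6} = subst (i <_) (sym a≡) (≤-trans (toWitness i<6) (m≤m+n 6 (c * 2)))

  1≤a : 1 ≤ a
  1≤a = bounded 0

  open Game a ℓ 1≤a 1+ℓ≡4a public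

  V : ℕ → ℕ → ℕ
  V k i = word (block k) (letter i)

  letter-even : ∀ m → letter (4 + m * 2) ≡ # 4
  letter-even zero    = refl
  letter-even (suc m) = cong (λ x → nextL (nextL x)) (letter-even m)

  -- For m = c this is the last letter a - 1 of a block; the evenness of a gives it class 5.
  letter-odd : ∀ m → letter (5 + m * 2) ≡ # 5
  letter-odd m = cong nextL (letter-even m)

  a-1<a : 5 + c * 2 < a
  a-1<a = ≤-reflexive (sym a≡)

  row-end : ∀ q {j} → suc j ≡ a → q * a + suc j ≡ suc q * a + 0
  row-end q 1+j≡a = trans (cong (q * a +_) 1+j≡a) (trans (+-comm (q * a) a) (sym (+-identityʳ _)))

  early : ∀ k i → k ≤ 3 → i < a → E (k * a + i) ≡ 9
  early k i k≤3 i<a = ext-unavailable (m≤n⇒m≤1+n (begin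
    suc (k * a + i) ≡⟨ +-suc (k * a) i ⟨
    k * a + suc i   ≤⟨ +-mono-≤ (*-monoˡ-≤ a k≤3) i<a ⟩
    3 * a + a       ≡⟨ +-comm (3 * a) a ⟩
    4 * a           ∎))
    where open ≤-Reasoning

  N-word : ∀ l → word (# 0) l ≡ 9
  N-word = toWitness {a? = Finₚ.all? λ _ → _ ≟ _} tt

  -- The option ℓ of letter i + 1 in block k + 4 is letter i + 2 of block k, or letter 0 of block k
  -- + 1 when i + 1 is the last letter. Both values are supplied by the induction in `E-value`.
  value-in-block : ∀ k i → (2 + i < a) ⊎ (2 + i ≡ a) →
    (2 + i < a → E (k * a + (2 + i)) ≡ V k (2 + i)) → E (suc k * a + 0) ≡ V (suc k) 0 →
    mex₃ (V (4 + k) i) (V (3 + k) (suc i)) (E (k * a + (2 + i))) ≡ V (4 + k) (suc i)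
  value-in-block k i (inj₁ 2+i<a) inside _ =
    trans (cong (mex₃ _ _) (inside 2+i<a)) (sym (inner-ok (block k) (letter i)))
  value-in-block k i (inj₂ 2+i≡a) _ carry with refl ← +-cancelˡ-≡ 2 i (4 + c * 2) (trans 2+i≡a a≡) = begin
    mex₃ (V (4 + k) i) (V (3 + k) (suc i)) (E (k * a + (2 + i)))
      ≡⟨ cong₃ mex₃ (cong (word (block (4 + k))) (letter-even c))
           (cong (word (block (3 + k))) (letter-odd c)) (trans (cong E (row-end k (sym a≡))) carry) ⟩
    _ ≡⟨ last-ok (block k) ⟨
    word (block (4 + k)) (# 5) ≡⟨ cong (word (block (4 + k))) (letter-odd c) ⟨
    V (4 + k) (suc i) ∎
    where open ≡-Reasoning

  -- Lexicographic induction on block and letter: blocks 0 to 3 are padding, and all three options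
  -- of a later letter precede it.
  E-value : ∀ k i → i < a → E (k * a + i) ≡ V k i
  E-value 0 i i<a = trans (early 0 i z≤n i<a) (sym (N-word (letter i)))
  E-value 1 i i<a = trans (early 1 i (s≤s z≤n) i<a) (sym (N-word (letter i)))
  E-value 2 i i<a = trans (early 2 i (s≤s (s≤s z≤n)) i<a) (sym (N-word (letter i)))
  E-value 3 i i<a = trans (early 3 i ≤-refl i<a) (sym (N-word (letter i)))
  -- Index 4a is the last padded one, since g starts at index 4a + 1.
  E-value 4 0 _ = ext-unavailable (s≤s (≤-reflexive (+-identityʳ (4 * a))))
  E-value (suc (suc (suc (suc (suc k))))) 0 0<a = begin
    E ((5 + k) * a + 0)            ≡⟨ cong E (trans (p₀ a (k * a)) (cong (λ x → 4 * a + (x + k * a)) a≡)) ⟩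
    E (4 * a + suc y)              ≡⟨ E-rec y ⟩
    mex₃ (E (4 * a + y)) (E (3 * a + suc y)) (E (2 + y))
      ≡⟨ cong₃ mex₃ (trans (cong E (p₁ a (k * a) (5 + c * 2)))
             (trans (E-value (suc (suc (suc (suc k)))) (5 + c * 2) a-1<a)
               (cong (word (block (4 + k))) (letter-odd c))))
           (trans (cong E (trans (cong (λ x → 3 * a + (x + k * a)) (sym a≡)) (p₂ a (k * a))))
             (E-value (suc (suc (suc (suc k)))) 0 1≤a))
           (trans (cong E (trans (cong (λ x → suc (x + k * a)) (sym a≡)) (+-comm 1 (a + k * a))))
             (E-value (suc k) 1 (bounded 1))) ⟩
    _ ≡⟨ first-ok (block k) ⟨
    V (5 + k) 0 ∎
    where
    open ≡-Reasoning
    y = (5 + c * 2) + k * a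
    p₀ : ∀ a x → a + (a + (a + (a + (a + x)))) + 0 ≡ 4 * a + (a + x)
    p₀ = solve-∀
    p₁ : ∀ a x z → 4 * a + (z + x) ≡ a + (a + (a + (a + x))) + z
    p₁ = solve-∀
    p₂ : ∀ a x → 3 * a + (a + x) ≡ a + (a + (a + (a + x))) + 0
    p₂ = solve-∀
  E-value (suc (suc (suc (suc k)))) (suc i) 1+i<a = begin
    E ((4 + k) * a + suc i)        ≡⟨ cong E (p₀ a (k * a) i) ⟩
    E (4 * a + suc y)              ≡⟨ E-rec y ⟩
    mex₃ (E (4 * a + y)) (E (3 * a + suc y)) (E (2 + y))
      ≡⟨ cong₃ mex₃ (trans (cong E (p₁ a (k * a) i))
             (E-value (suc (suc (suc (suc k)))) i (<-trans (n<1+n i) 1+i<a)))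
           (trans (cong E (p₂ a (k * a) i)) (E-value (suc (suc (suc k))) (suc i) 1+i<a))
           (cong E (p₃ (k * a) i)) ⟩
    mex₃ (V (4 + k) i) (V (3 + k) (suc i)) (E (k * a + suc (suc i)))
      ≡⟨ value-in-block k i (m≤n⇒m<n∨m≡n 1+i<a) (E-value k (2 + i)) (E-value (suc k) 0 1≤a) ⟩
    V (4 + k) (suc i) ∎
    where
    open ≡-Reasoning
    y = k * a + i
    p₀ : ∀ a x i → a + (a + (a + (a + x))) + suc i ≡ 4 * a + suc (x + i)
    p₀ = solve-∀
    p₁ : ∀ a x i → 4 * a + (x + i) ≡ a + (a + (a + (a + x))) + i
    p₁ = solve-∀
    p₂ : ∀ a x i → 3 * a + suc (x + i) ≡ a + (a + (a + x)) + suc i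
    p₂ = solve-∀
    p₃ : ∀ x i → 2 + (x + i) ≡ x + suc (suc i)
    p₃ = solve-∀

  g-value : ∀ n k i → i < a → 4 * a + suc n ≡ k * a + i → g n ≡ V k i
  g-value n k i i<a eq = trans (sym (E-shift n)) (trans (cong E eq) (E-value k i i<a))

  locate : ∀ n → ∃₂ λ k i → i < a × n ≡ k * a + i
  locate n with result q i eq ← (n divMod a) {{>-nonZero 1≤a}} =
    q , toℕ i , Finₚ.toℕ<n i , trans eq (+-comm (toℕ i) (q * a))

  -- Period and nim-sequence for a ≥ 6.

  block-periodic : ∀ k → block (13 + k) ≡ block (9 + k)
  block-periodic zero    = refl
  block-periodic (suc k) = cong nextB (block-periodic k)

  block-cycle : ∀ m k → block (m * 4 + (9 + k)) ≡ block (9 + k)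
  block-cycle zero    k = refl
  block-cycle (suc m) k =
    trans (cong (λ κ → orbit nextB κ 4) (block-cycle m k)) (block-periodic k)

  -- 4a + 1 + n₀ = 11a + 4: the periodic part starts at letter 4 of block 11.
  n₀ : ℕ
  n₀ = 7 * a + 3

  periodic : PeriodicFrom g n₀ (4 * a)
  -- The index of n₀ + n in `E` is 11a + (4 + n), hence the division of 4 + n by a.
  periodic n with k , i , i<a , eq ← locate (4 + n) = begin
    g (4 * a + (n₀ + n)) ≡⟨ g-value _ (15 + k) i i<a
                              (trans (later a n) (trans (cong (15 * a +_) eq) (regroup a k i 15))) ⟩
    V (15 + k) i         ≡⟨ cong (λ κ → word κ (letter i)) (block-periodic (2 + k)) ⟩
    V (11 + k) i         ≡⟨ g-value _ (11 + k) i i<a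
                              (trans (sooner a n) (trans (cong (11 * a +_) eq) (regroup a k i 11))) ⟨
    g (n₀ + n)           ∎
    where
    open ≡-Reasoning
    later : ∀ a n → 4 * a + suc (4 * a + (7 * a + 3 + n)) ≡ 15 * a + (4 + n)
    later = solve-∀
    sooner : ∀ a n → 4 * a + suc (7 * a + 3 + n) ≡ 11 * a + (4 + n)
    sooner = solve-∀
    regroup : ∀ a k i x → x * a + (k * a + i) ≡ (x + k) * a + i
    regroup = solve-∀

  -- Reads k i w: the word w is read in E from letter i of block k on.
  infixr 5 _∷⟨_⟩_
  data Reads : ℕ → ℕ → List ℕ → Set where
    []      : ∀ {k i} → Reads k i []
    _∷⟨_⟩_  : ∀ {k i x w} → V k i ≡ x → i < a → Reads k (suc i) w → Reads k i (x ∷ w)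
    carry   : ∀ {k w} → Reads (suc k) 0 w → Reads k (6 + c * 2) w

  Reads⇒Spells : ∀ {k i w n} → Reads k i w → 4 * a + suc n ≡ k * a + i → Spells g n w
  Reads⇒Spells []                _   = tt
  Reads⇒Spells {k} {i} {n = n} (eq ∷⟨ i<a ⟩ rs) pos = trans (g-value n k i i<a pos) eq ,
    Reads⇒Spells rs (trans (+-suc (4 * a) (suc n)) (trans (cong suc pos) (sym (+-suc (k * a) i))))
  Reads⇒Spells {k} (carry rs)    pos = Reads⇒Spells rs (trans pos (row-end k (sym a≡)))

  infixr 5 _∷ₛ_
  _∷ₛ_ : ∀ {k i w} x → {eq : True (V k i ≟ x)} {i<6 : True (i <? 6)} → Reads k (suc i) w → Reads k i (x ∷ w)
  _∷ₛ_ {i = i} x {eq} {i<6} rs = toWitness eq ∷⟨ bounded i {i<6} ⟩ rs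

  -- Where the letter classes have period two, a pair 01 read once recurs at every repetition. This
  -- reads the stretches whose length grows with a.
  read-run : ∀ m {k i w} → m * 2 + i ≤ a → letter (2 + i) ≡ letter i → V k i ≡ 0 → V k (suc i) ≡ 1 →
    Reads k (m * 2 + i) w → Reads k i (rep m zeroOne ++ w)
  read-run zero    _  _   _   _   rs = rs
  read-run (suc m) {k} {i} {w} ≤a per eq₀ eq₁ rs =
    eq₀ ∷⟨ <-trans (n<1+n i) 1+i<a ⟩ eq₁ ∷⟨ 1+i<a ⟩
    read-run m (subst (_≤ a) (sym shift) ≤a) (cong (λ x → nextL (nextL x)) per)
      (trans (cong (word (block k)) per) eq₀) (trans (cong (λ x → word (block k) (nextL x)) per) eq₁)
      (subst (λ x → Reads k x w) (sym shift) rs)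
    where
    shift : m * 2 + (2 + i) ≡ 2 + (m * 2 + i)
    shift = trans (+-suc (m * 2) (suc i)) (cong suc (+-suc (m * 2) i))
    1+i<a : suc i < a
    1+i<a = ≤-trans (s≤s (s≤s (m≤n+m i (m * 2)))) ≤a

  -- Each run is cut so as to begin where the reading has reached letter 4 or 5 of a block; the
  -- explicit letters fill the end of that block and the start of the next.
  nimSequence-split : nimSequence (3 + c) ≡
    rep c zeroOne ++ (0 ∷ 1 ∷ 0 ∷ 1 ∷ 2 ∷
    0 ∷ 1 ∷ rep c zeroOne ++ (0 ∷ 1 ∷ 2 ∷
    0 ∷ 1 ∷ rep c zeroOne ++ (0 ∷ 1 ∷ 0 ∷ 1 ∷ 2 ∷
    0 ∷ 1 ∷ rep c zeroOne ++ (0 ∷ 1 ∷ 0 ∷ 1 ∷ 2 ∷ []))))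
  nimSequence-split = begin
    (s ++ (s ++ [])) ++ rep 2 t                ≡⟨ ++-assoc s (s ++ []) _ ⟩
    s ++ ((s ++ []) ++ rep 2 t)                ≡⟨ cong (s ++_) (++-assoc s [] _) ⟩
    s ++ (s ++ (t ++ (t ++ [])))               ≡⟨ segment-split² c _ ⟩
    run (0 ∷ 1 ∷ 0 ∷ 1 ∷ 2 ∷ s ++ (t ++ (t ++ [])))
      ≡⟨ cong (λ y → run (0 ∷ 1 ∷ 0 ∷ 1 ∷ 2 ∷ 0 ∷ 1 ∷ y)) (segment-split c _) ⟩
    run (0 ∷ 1 ∷ 0 ∷ 1 ∷ 2 ∷ 0 ∷ 1 ∷ run (0 ∷ 1 ∷ 2 ∷ t ++ (t ++ [])))
      ≡⟨ cong (λ y → run (0 ∷ 1 ∷ 0 ∷ 1 ∷ 2 ∷ 0 ∷ 1 ∷ run (0 ∷ 1 ∷ 2 ∷ 0 ∷ 1 ∷ y)))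
           (trans (segment-split² c _)
             (cong (λ y → run (0 ∷ 1 ∷ 0 ∷ 1 ∷ 2 ∷ 0 ∷ 1 ∷ y)) (segment-split² c []))) ⟩
    _ ∎
    where
    open ≡-Reasoning
    s = segment (2 + c)
    t = segment (3 + c)
    run : List ℕ → List ℕ
    run y = rep c zeroOne ++ y

  infixr 5 _∷ₑ_ _∷ₒ_
  -- This and `_∷ₒ_` read letters a - 2 and a - 1, of classes 4 and 5; after the second the reading
  -- enters the next block.
  _∷ₑ_ : ∀ {k w} x → {True (word (block k) (# 4) ≟ x)} → Reads k (5 + c * 2) w → Reads k (4 + c * 2) (x ∷ w)
  _∷ₑ_ {k} x {eq} rs = trans (cong (word (block k)) (letter-even c)) (toWitness eq) ∷⟨ <-trans (n<1+n _) a-1<a ⟩ rs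

  _∷ₒ_ : ∀ {k w} x → {True (word (block k) (# 5) ≟ x)} → Reads (suc k) 0 w → Reads k (5 + c * 2) (x ∷ w)
  _∷ₒ_ {k} x {eq} rs = trans (cong (word (block k)) (letter-odd c)) (toWitness eq) ∷⟨ a-1<a ⟩ carry rs

  read-middle : ∀ {k w} i {_ : True (i ≤? 5)} {_ : True (letter (2 + i) Finₚ.≟ letter i)}
    {_ : True (V k i ≟ 0)} {_ : True (V k (suc i) ≟ 1)} →
    Reads k (i + c * 2) w → Reads k i (rep c zeroOne ++ w)
  read-middle {k} {w} i {i≤5} {per} {eq₀} {eq₁} rs = read-run c
    (≤-trans (+-monoʳ-≤ (c * 2) (toWitness i≤5)) (≤-trans (≤-reflexive (+-comm (c * 2) 5)) (<⇒≤ a-1<a)))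
    (toWitness per) (toWitness eq₀) (toWitness eq₁) (subst (λ x → Reads k x w) (+-comm i (c * 2)) rs)

  reads-nimSequence : Reads 11 4 (nimSequence (3 + c))
  reads-nimSequence = subst (Reads 11 4) (sym nimSequence-split)
    (read-middle 4 (0 ∷ₑ 1 ∷ₒ 0 ∷ₛ 1 ∷ₛ 2 ∷ₛ
    0 ∷ₛ 1 ∷ₛ read-middle 5 (0 ∷ₒ 1 ∷ₛ 2 ∷ₛ
    0 ∷ₛ 1 ∷ₛ read-middle 4 (0 ∷ₑ 1 ∷ₒ 0 ∷ₛ 1 ∷ₛ 2 ∷ₛ
    0 ∷ₛ 1 ∷ₛ read-middle 5 (0 ∷ₒ 1 ∷ₛ 0 ∷ₛ 1 ∷ₛ 2 ∷ₛ [])))))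

  length-nimSequence : length (nimSequence (3 + c)) ≡ 4 * a
  length-nimSequence = begin
    length (nimSequence (3 + c)) ≡⟨ cong length nimSequence-split ⟩
    _ ≡⟨ trans (length-run c _) (cong (λ x → c * 2 + (7 + x)) (trans (length-run c _)
          (cong (λ x → c * 2 + (5 + x)) (trans (length-run c _)
          (cong (λ x → c * 2 + (7 + x)) (length-run c _)))))) ⟩
    c * 2 + (7 + (c * 2 + (5 + (c * 2 + (7 + (c * 2 + 5)))))) ≡⟨ total (c * 2) ⟩
    4 * (6 + c * 2) ≡⟨ cong (4 *_) a≡ ⟨
    4 * a ∎
    where
    open ≡-Reasoning
    total : ∀ x → x + (7 + (x + (5 + (x + (7 + (x + 5)))))) ≡ 4 * (6 + x)
    total = solve-∀

  -- Shifts seen through classes, and failure of smaller periods for a ≥ 6.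

  letter≡0 : ∀ j → letter j ≡ # 0 → j ≡ 0
  letter≡0 zero    _  = refl
  letter≡0 (suc j) eq = ⊥-elim (nextL≢0 (letter j) eq)
    where
    -- The cycle of letter classes is 4, 5, so no later letter returns to class 0.
    nextL≢0 : ∀ l → nextL l ≢ # 0
    nextL≢0 = toWitness {a? = Finₚ.all? λ _ → ¬? (_ Finₚ.≟ _)} tt

  letter≡1 : ∀ j → letter j ≡ # 1 → j ≡ 1
  letter≡1 (suc j) eq = cong suc (letter≡0 j (nextL≡1 (letter j) eq))
    where
    nextL≡1 : ∀ l → nextL l ≡ # 1 → l ≡ # 0
    nextL≡1 = toWitness {a? = Finₚ.all? λ _ → (_ Finₚ.≟ _) →-dec (_ Finₚ.≟ _)} tt

  letter-last : ∀ {j} → suc j ≡ a → letter j ≡ # 5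
  letter-last {j} 1+j≡a with refl ← suc-injective (trans 1+j≡a a≡) = letter-odd c

  -- A shift by q blocks and j letters acts only through the classes of q and j, so finitely many
  -- checks cover all shifts.
  V-shift : ∀ q k j i → V (k + q) (i + j) ≡ word (orbit nextB (block q) k) (orbit nextL (letter j) i)
  V-shift q k j i = cong₂ word (orbit-+ nextB Fin.zero k q) (orbit-+ nextL Fin.zero i j)

  -- Letters i ≤ 1 suffice, so that adding j < a − 1 does not leave the block.
  differ-inner : ∀ (d : Fin 4) l → (toℕ d ≡ 0 × l ≡ # 0) ⊎ ∃₂ λ (k : Fin 4) (i : Fin 2) →
    word (orbit nextB (block (toℕ d)) (12 + toℕ k)) (orbit nextL l (toℕ i)) ≢ V (12 + toℕ k) (toℕ i)
  differ-inner = toWitness {a? = Finₚ.all? λ d → Finₚ.all? λ l →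
    ((_ ≟ _) ×-dec (_ Finₚ.≟ _)) ⊎-dec Finₚ.any? λ k → Finₚ.any? λ i → ¬? (_ ≟ _)} tt

  -- The 2 is letter 1 of block 13, which a shift by d * a + (a - 1) takes to letter 0 of block 14 +
  -- d.
  differ-last : ∀ (d : Fin 4) → V (14 + toℕ d) 0 ≢ 2
  differ-last = toWitness {a? = Finₚ.all? λ _ → ¬? (_ ≟ _)} tt

  quotient<4 : ∀ {d j q} → q < 4 * a → q ≡ d * a + j → d < 4
  quotient<4 {d} {j} q<4a refl = *-cancelʳ-< a d 4 (≤-<-trans (m≤m+n (d * a) j) q<4a)

  aperiodic : ∀ q → 0 < q → q < 4 * a → ∃ λ n → g (n₀ + n + q) ≢ g (n₀ + n)
  aperiodic q 0<q q<4a with d , j , j<a , refl ← locate q = witness (m≤n⇒m<n∨m≡n j<a)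
    where
    f = Fin.fromℕ< (quotient<4 q<4a refl)
    d≡ : toℕ f ≡ d
    d≡ = Finₚ.toℕ-fromℕ< (quotient<4 q<4a refl)
    -- Since 2 + c * 2 = a - 4, this offset leads from letter 4 of block 11 to letter i of block 12
    -- + k.
    at : ℕ → ℕ → ℕ
    at k i = (2 + c * 2) + (k * a + i)
    at-position : ∀ k i → 4 * a + suc (n₀ + at k i) ≡ (12 + k) * a + i
    at-position k i = trans (before a (c * 2) (k * a + i))
      (trans (cong (λ x → 11 * a + (x + (k * a + i))) (sym a≡)) (after a k i))
      where
      before : ∀ a x y → 4 * a + suc (7 * a + 3 + ((2 + x) + y)) ≡ 11 * a + ((6 + x) + y)
      before = solve-∀
      after : ∀ a k i → 11 * a + (a + (k * a + i)) ≡ (12 + k) * a + i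
      after = solve-∀
    shift : ∀ {n} k i → 4 * a + suc (n₀ + n) ≡ k * a + i →
      4 * a + suc (n₀ + n + (d * a + j)) ≡ (k + d) * a + (i + j)
    shift {n} k i eq = trans (+-suc-assoc (4 * a) (n₀ + n) (d * a + j))
      (trans (cong (_+ (d * a + j)) eq) (regroup a k d i j))
      where
      regroup : ∀ a k d i j → k * a + i + (d * a + j) ≡ (k + d) * a + (i + j)
      regroup = solve-∀
    distinguish : ∀ {x} k i k′ i′ → i < a → i′ < a → (12 + k + d) * a + (i + j) ≡ k′ * a + i′ →
      V k′ i′ ≡ x → x ≢ V (12 + k) i → g (n₀ + at k i + (d * a + j)) ≢ g (n₀ + at k i)
    distinguish k i k′ i′ i<a i′<a pos eq x≢ same = x≢ (trans (sym eq)
      (trans (sym (g-value _ k′ i′ i′<a (trans (shift (12 + k) i (at-position k i)) pos)))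
        (trans same (g-value _ (12 + k) i i<a (at-position k i)))))
    inner-case : suc j < a →
      ((toℕ f ≡ 0 × letter j ≡ # 0) ⊎ ∃₂ λ (k : Fin 4) (i : Fin 2) →
        word (orbit nextB (block (toℕ f)) (12 + toℕ k)) (orbit nextL (letter j) (toℕ i)) ≢ V (12 + toℕ k) (toℕ i)) →
      ∃ λ n → g (n₀ + n + (d * a + j)) ≢ g (n₀ + n)
    inner-case _ (inj₁ (f≡0 , l≡0)) =
      ⊥-elim (<⇒≢ 0<q (sym (cong₂ (λ x y → x * a + y) (trans (sym d≡) f≡0) (letter≡0 j l≡0))))
    inner-case 1+j<a (inj₂ (k , i , differ)) = at (toℕ k) (toℕ i) ,
      distinguish (toℕ k) (toℕ i) (12 + toℕ k + d) (toℕ i + j) (<-trans (Finₚ.toℕ<n i) (bounded 2))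
        (≤-<-trans (+-monoˡ-≤ j (≤-pred (Finₚ.toℕ<n i))) 1+j<a) refl
        (trans (V-shift d (12 + toℕ k) j (toℕ i))
          (cong (λ d → word (orbit nextB (block d) (12 + toℕ k)) (orbit nextL (letter j) (toℕ i))) (sym d≡)))
        differ
    witness : suc j < a ⊎ suc j ≡ a → ∃ λ n → g (n₀ + n + (d * a + j)) ≢ g (n₀ + n)
    witness (inj₁ 1+j<a) = inner-case 1+j<a (differ-inner f (letter j))
    witness (inj₂ 1+j≡a) = at 1 1 , distinguish 1 1 (14 + d) 0 (bounded 1) 1≤a
      (row-end (13 + d) 1+j≡a)
      (cong (λ d → V (14 + d) 0) (sym d≡)) (differ-last f)

  ultimatelyPeriodic : UltPeriodic S (4 * a) (nimSequence (3 + c))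
  ultimatelyPeriodic = ultPeriodic S (λ _ → refl) n₀ (4 * a) (nimSequence (3 + c))
    (≤-trans 1≤a (m≤m+n a (3 * a))) periodic
    length-nimSequence (Reads⇒Spells reads-nimSequence (start a)) aperiodic
    where
    start : ∀ a → 4 * a + suc (7 * a + 3) ≡ 11 * a + 4
    start = solve-∀

  -- The expansion for a ≥ 6.

  Expansion : ℕ → Set
  Expansion s = s ∈ (1 ∷ a ∷ ℓ ∷ []) ⊎ Star ((4 * a + 1) ∷ (5 * a) ∷ []) (4 * a) s

  position : ∀ n → ∃₂ λ k i → i < a × 4 * a + suc n ≡ (4 + k) * a + i
  position n with k , i , i<a , eq ← locate (suc n) =
    k , i , i<a , trans (cong (4 * a +_) eq) (regroup a k i)
    where
    regroup : ∀ a k i → 4 * a + (k * a + i) ≡ (4 + k) * a + i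
    regroup = solve-∀

  5a-differ : ∀ κ l → word (orbit nextB κ 9) l ≢ word (orbit nextB κ 4) l
  5a-differ = toWitness {a? = Finₚ.all? λ _ → Finₚ.all? λ _ → ¬? (_ ≟ _)} tt

  -- A shift by 5a keeps the letter and moves block 4 + k to block 9 + k. That one is already in the
  -- cycle, so 4m further blocks change nothing.
  5a-star : ∀ m n → g (n + (5 * a + m * (4 * a))) ≢ g n
  5a-star m n eq with k , i , i<a , pos ← position n = 5a-differ (block k) (letter i) (begin
    V (9 + k) i ≡⟨ cong (λ κ → word κ (letter i)) (block-cycle m k) ⟨
    V (m * 4 + (9 + k)) i ≡⟨ g-value _ (m * 4 + (9 + k)) i i<a
       (trans (+-suc-assoc (4 * a) n _) (trans (cong (_+ (5 * a + m * (4 * a))) pos) (regroup a k i m))) ⟨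
    g (n + (5 * a + m * (4 * a))) ≡⟨ eq ⟩
    g n ≡⟨ g-value n (4 + k) i i<a pos ⟩
    V (4 + k) i ∎)
    where
    open ≡-Reasoning
    regroup : ∀ a k i m → (4 + k) * a + i + (5 * a + m * (4 * a)) ≡ (m * 4 + (9 + k)) * a + i
    regroup = solve-∀

  -- Block 8 precedes the cycle, so for k = 0 the shifts with m = 0 and m > 0 reach different words;
  -- block 12 + k represents the latter.
  block-later : ∀ m k → block (m * 4 + (8 + k)) ≡ block (8 + k) ⊎ block (m * 4 + (8 + k)) ≡ block (12 + k)
  block-later zero    k = inj₁ refl
  block-later (suc m) k = inj₂ (trans (cong block (rearrange (m * 4) k)) (block-cycle m (3 + k)))
    where
    rearrange : ∀ x k → 4 + (x + (8 + k)) ≡ x + (12 + k)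
    rearrange = solve-∀

  -- The pair treats m = 0 and m > 0 when the shifted letter stays in its block. In the last clause
  -- letter a - 1 is carried to letter 0 of block 9 + k, where m no longer matters.
  4a+1-differ : ∀ κ → (∀ l → word (orbit nextB κ 8) (nextL l) ≢ word (orbit nextB κ 4) l
                           × word (orbit nextB κ 12) (nextL l) ≢ word (orbit nextB κ 4) l)
                    × word (orbit nextB κ 9) (# 0) ≢ word (orbit nextB κ 4) (# 5)
  4a+1-differ = toWitness {a? = Finₚ.all? λ _ → (Finₚ.all? λ _ → ¬? (_ ≟ _) ×-dec ¬? (_ ≟ _)) ×-dec ¬? (_ ≟ _)} tt

  4a+1-star : ∀ m n → g (n + (4 * a + 1 + m * (4 * a))) ≢ g n
  4a+1-star m n eq with k , i , i<a , pos ← position n = go (m≤n⇒m<n∨m≡n i<a)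
    where
    open ≡-Reasoning
    regroup : ∀ a k i m → (4 + k) * a + i + (4 * a + 1 + m * (4 * a)) ≡ (m * 4 + (8 + k)) * a + suc i
    regroup = solve-∀
    overflow : ∀ a k m → (m * 4 + (8 + k)) * a + a ≡ (m * 4 + (9 + k)) * a + 0
    overflow = solve-∀
    pos′ : 4 * a + suc (n + (4 * a + 1 + m * (4 * a))) ≡ (m * 4 + (8 + k)) * a + suc i
    pos′ = trans (+-suc-assoc (4 * a) n _) (trans (cong (_+ (4 * a + 1 + m * (4 * a))) pos) (regroup a k i m))
    equal : ∀ {κ} k′ i′ → i′ < a → 4 * a + suc (n + (4 * a + 1 + m * (4 * a))) ≡ k′ * a + i′ →
      block k′ ≡ κ → word κ (letter i′) ≡ V (4 + k) i
    equal k′ i′ i′<a pos′ refl = trans (sym (g-value _ k′ i′ i′<a pos′)) (trans eq (g-value n (4 + k) i i<a pos))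
    go : suc i < a ⊎ suc i ≡ a → _
    go (inj₁ 1+i<a) with block-later m k
    ... | inj₁ same  = proj₁ (proj₁ (4a+1-differ (block k)) (letter i))
      (equal (m * 4 + (8 + k)) (suc i) 1+i<a pos′ same)
    ... | inj₂ later = proj₂ (proj₁ (4a+1-differ (block k)) (letter i))
      (equal (m * 4 + (8 + k)) (suc i) 1+i<a pos′ later)
    go (inj₂ 1+i≡a) = proj₂ (4a+1-differ (block k))
      (trans
        (equal (m * 4 + (9 + k)) 0 1≤a
          (trans pos′ (trans (cong ((m * 4 + (8 + k)) * a +_) 1+i≡a) (overflow a k m))) (block-cycle m k))
        (cong (word (block (4 + k))) (letter-last 1+i≡a)))

  Expansion⇒InExpansion : ∀ s → Expansion s → InExpansion S s
  Expansion⇒InExpansion s (inj₁ s∈S) = 1≤s s∈S , λ n → G≢option S s∈S (1≤s s∈S) n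
    where
    1≤s : ∀ {s} → s ∈ S → 1 ≤ s
    1≤s (here refl)                 = ≤-refl
    1≤s (there (here refl))         = 1≤a
    1≤s (there (there (here refl))) = ≤-trans 1≤a a≤ℓ
  Expansion⇒InExpansion s (inj₂ (_ , here refl , m , refl)) =
    ≤-trans (m≤n+m 1 (4 * a)) (m≤m+n _ _) , 4a+1-star m
  Expansion⇒InExpansion s (inj₂ (_ , there (here refl) , m , refl)) =
    ≤-trans 1≤a (≤-trans (m≤m+n a (4 * a)) (m≤m+n _ _)) , 5a-star m

  -- E in block 8 is still preperiodic, so m = 0, 1, 2 have to be kept apart.
  block-class : ∀ d m → ∃ λ (μ : Fin 4) → block (d + m * 4) ≡ block (d + toℕ μ * 4) × (toℕ μ ≡ 0 → m ≡ 0)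
  block-class d 0 = # 0 , refl , λ _ → refl
  block-class d 1 = # 1 , refl , λ ()
  block-class d 2 = # 2 , refl , λ ()
  block-class d (suc (suc (suc m))) =
    # 3 , trans (cong block (to d (m * 4))) (trans (block-cycle m (3 + d)) (cong block (+-comm 12 d))) , λ ()
    where
    to : ∀ d x → d + (12 + x) ≡ x + (12 + d)
    to = solve-∀

  -- For s = (d + 4m)a + j the exceptions are s = 0, s = 1 + 4am and s = a + 4am. The condition 0 <
  -- k + i leaves out letter 0 of block 4, which is padding and no value of `g`.
  collide-inner : ∀ (d μ : Fin 4) l → let κ = block (toℕ d + toℕ μ * 4) in
      (toℕ d ≡ 0 × toℕ μ ≡ 0 × l ≡ # 0) ⊎ (toℕ d ≡ 0 × l ≡ # 1) ⊎ (toℕ d ≡ 1 × l ≡ # 0)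
    ⊎ ∃₂ λ (k : Fin 9) (i : Fin 2) → 0 < toℕ k + toℕ i ×
        word (orbit nextB κ (4 + toℕ k)) (orbit nextL l (toℕ i)) ≡ V (4 + toℕ k) (toℕ i)
  collide-inner = toWitness {a? = Finₚ.all? λ _ → Finₚ.all? λ _ → Finₚ.all? λ _ →
    ((_ ≟ _) ×-dec ((_ ≟ _) ×-dec (_ Finₚ.≟ _))) ⊎-dec (((_ ≟ _) ×-dec (_ Finₚ.≟ _)) ⊎-dec
    (((_ ≟ _) ×-dec (_ Finₚ.≟ _)) ⊎-dec Finₚ.any? λ _ → Finₚ.any? λ _ → (_ ≤? _) ×-dec (_ ≟ _)))} tt

  -- For j = a - 1 the only exception is s = ℓ. Otherwise s already fails at n = 0, which is letter
  -- 1 of block 4, or at letter 0 of block 9.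
  collide-last : ∀ (d μ : Fin 4) → let κ = block (toℕ d + toℕ μ * 4) in
      (toℕ d ≡ 3 × toℕ μ ≡ 0) ⊎ word (orbit nextB κ 5) (# 0) ≡ V 4 1 ⊎ word (orbit nextB κ 9) (# 5) ≡ V 9 0
  collide-last = toWitness {a? = Finₚ.all? λ _ → Finₚ.all? λ _ →
    ((_ ≟ _) ×-dec (_ ≟ _)) ⊎-dec ((_ ≟ _) ⊎-dec (_ ≟ _))} tt

  collision : ∀ q j k i k′ i′ → i < a → i′ < a → 0 < k * a + i →
    (4 + k + q) * a + (i + j) ≡ k′ * a + i′ → V k′ i′ ≡ V (4 + k) i → ¬ InExpansion S (q * a + j)
  collision q j k i k′ i′ i<a i′<a 0<n pos′ eq (_ , avoids) =
    avoids n (trans (g-value _ k′ i′ i′<a (trans (+-suc-assoc (4 * a) n (q * a + j)) (trans (cong (_+ (q * a + j)) pos)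
      (trans (regroup a k q i j) pos′)))) (trans eq (sym (g-value n (4 + k) i i<a pos))))
    where
    -- The predecessor undoes the extra 1 in the shift by 4a + 1.
    n = pred (k * a + i)
    pos : 4 * a + suc n ≡ (4 + k) * a + i
    pos = trans (cong (4 * a +_) (suc-pred (k * a + i) {{>-nonZero 0<n}})) (start a k i)
      where
      start : ∀ a k i → 4 * a + (k * a + i) ≡ (4 + k) * a + i
      start = solve-∀
    regroup : ∀ a k q i j → (4 + k) * a + i + (q * a + j) ≡ (4 + k + q) * a + (i + j)
    regroup = solve-∀

  1a-expansion : ∀ m → Expansion ((1 + m * 4) * a + 0)
  1a-expansion zero    = inj₁ (there (here (first a)))
    where
    first : ∀ a → 1 * a + 0 ≡ a
    first = solve-∀
  1a-expansion (suc m) = inj₂ (5 * a , there (here refl) , m , regroup a m)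
    where
    regroup : ∀ a m → (1 + (4 + m * 4)) * a + 0 ≡ 5 * a + m * (4 * a)
    regroup = solve-∀

  0a+1-expansion : ∀ m → Expansion ((m * 4) * a + 1)
  0a+1-expansion zero    = inj₁ (here refl)
  0a+1-expansion (suc m) = inj₂ (4 * a + 1 , here refl , m , regroup a m)
    where
    regroup : ∀ a m → (4 + m * 4) * a + 1 ≡ 4 * a + 1 + m * (4 * a)
    regroup = solve-∀

  ℓ-expansion : ∀ {j} → suc j ≡ a → Expansion (3 * a + j)
  ℓ-expansion {j} 1+j≡a = inj₁ (there (there (here (suc-injective
    (trans (sym (+-suc (3 * a) j)) (trans (cong (3 * a +_) 1+j≡a) (trans (+-comm (3 * a) a) (sym 1+ℓ≡4a))))))))

  -- Both m and its class μ are kept: collisions depend on μ alone, while the member of the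
  -- expansion that is found depends on m.
  module Classify (d : Fin 4) (m j : ℕ) (μ : Fin 4) (class≡ : block (toℕ d + m * 4) ≡ block (toℕ d + toℕ μ * 4))
    (μ≡0⇒m≡0 : toℕ μ ≡ 0 → m ≡ 0) (inExp : InExpansion S ((toℕ d + m * 4) * a + j)) where

    q = toℕ d + m * 4
    κ = block (toℕ d + toℕ μ * 4)

    V-class : ∀ k i → V (k + q) (i + j) ≡ word (orbit nextB κ k) (orbit nextL (letter j) i)
    V-class k i = trans (V-shift q k j i) (cong (λ κ → word (orbit nextB κ k) (orbit nextL (letter j) i)) class≡)

    inner-case : suc j < a →
        (toℕ d ≡ 0 × toℕ μ ≡ 0 × letter j ≡ # 0) ⊎ (toℕ d ≡ 0 × letter j ≡ # 1) ⊎ (toℕ d ≡ 1 × letter j ≡ # 0)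
      ⊎ (∃₂ λ (k : Fin 9) (i : Fin 2) → 0 < toℕ k + toℕ i ×
          word (orbit nextB κ (4 + toℕ k)) (orbit nextL (letter j) (toℕ i)) ≡ V (4 + toℕ k) (toℕ i)) →
      Expansion (q * a + j)
    inner-case _ (inj₁ (d≡0 , μ≡0 , l≡0)) = ⊥-elim (<⇒≢ (proj₁ inExp)
      (sym (cong₂ (λ x y → x * a + y) (cong₂ (λ x y → x + y * 4) d≡0 (μ≡0⇒m≡0 μ≡0)) (letter≡0 j l≡0))))
    inner-case _ (inj₂ (inj₁ (d≡0 , l≡1))) = subst Expansion
      (sym (cong₂ (λ x y → (x + m * 4) * a + y) d≡0 (letter≡1 j l≡1))) (0a+1-expansion m)
    inner-case _ (inj₂ (inj₂ (inj₁ (d≡1 , l≡0)))) = subst Expansion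
      (sym (cong₂ (λ x y → (x + m * 4) * a + y) d≡1 (letter≡0 j l≡0))) (1a-expansion m)
    inner-case 1+j<a (inj₂ (inj₂ (inj₂ (k , i , 0<k+i , same)))) = ⊥-elim
      (collision q j (toℕ k) (toℕ i) (4 + toℕ k + q) (toℕ i + j) (<-trans (Finₚ.toℕ<n i) (bounded 2))
        (≤-<-trans (+-monoˡ-≤ j (≤-pred (Finₚ.toℕ<n i))) 1+j<a)
        (<-≤-trans 0<k+i (+-monoˡ-≤ (toℕ i) (m≤m*n (toℕ k) a {{>-nonZero 1≤a}})))
        refl (trans (V-class (4 + toℕ k) (toℕ i)) same) inExp)

    last-case : suc j ≡ a →
        (toℕ d ≡ 3 × toℕ μ ≡ 0) ⊎ word (orbit nextB κ 5) (# 0) ≡ V 4 1 ⊎ word (orbit nextB κ 9) (# 5) ≡ V 9 0 →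
      Expansion (q * a + j)
    last-case 1+j≡a (inj₁ (d≡3 , μ≡0)) = subst Expansion
      (sym (cong (λ x → x * a + j) (cong₂ (λ x y → x + y * 4) d≡3 (μ≡0⇒m≡0 μ≡0)))) (ℓ-expansion 1+j≡a)
    last-case 1+j≡a (inj₂ (inj₁ same)) = ⊥-elim (collision q j 0 1 (5 + q) 0 (bounded 1) 1≤a (s≤s z≤n)
      (row-end (4 + q) 1+j≡a)
      (trans (cong (λ κ → word κ (# 0))
        (trans (orbit-+ nextB Fin.zero 5 q) (cong (λ κ → orbit nextB κ 5) class≡))) same) inExp)
    last-case 1+j≡a (inj₂ (inj₂ same)) = ⊥-elim (collision q j 5 0 (9 + q) j 1≤a (≤-reflexive 1+j≡a)
      (≤-trans 1≤a (≤-trans (m≤m+n a (4 * a)) (m≤m+n _ 0))) refl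
      (trans (V-class 9 0) (trans (cong (word (orbit nextB κ 9)) (letter-last 1+j≡a)) same)) inExp)

    classify : suc j < a ⊎ suc j ≡ a → Expansion (q * a + j)
    classify (inj₁ 1+j<a) = inner-case 1+j<a (collide-inner d μ (letter j))
    classify (inj₂ 1+j≡a) = last-case 1+j≡a (collide-last d μ)

  InExpansion⇒Expansion : ∀ s → InExpansion S s → Expansion s
  InExpansion⇒Expansion s inExp =
    let k , j , j<a , s≡ = locate s
        result m d k≡ = k divMod 4
        μ , class≡ , μ≡0⇒m≡0 = block-class (toℕ d) m
        s≡′ = trans s≡ (cong (λ x → x * a + j) k≡)
    in subst Expansion (sym s≡′) (Classify.classify d m j μ class≡ μ≡0⇒m≡0
         (subst (InExpansion S) s≡′ inExp) (m≤n⇒m<n∨m≡n j<a))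

  hasExpansion : HasExpansion S Expansion
  hasExpansion s = mk⇔ (InExpansion⇒Expansion s) (Expansion⇒InExpansion s)

-- The case a = 4.

module FourCoins where

  open Game 4 15 (s≤s z≤n) refl

  -- The padding, the preperiod of length 31, and one period.
  values : Vec ℕ 64
  values =
    9 ∷ 9 ∷ 9 ∷ 9 ∷ 9 ∷ 9 ∷ 9 ∷ 9 ∷ 9 ∷ 9 ∷ 9 ∷ 9 ∷ 9 ∷ 9 ∷ 9 ∷ 9 ∷ 9 ∷
    0 ∷ 1 ∷ 0 ∷ 1 ∷ 2 ∷ 0 ∷ 1 ∷ 0 ∷ 1 ∷ 2 ∷ 0 ∷ 1 ∷ 0 ∷ 1 ∷ 2 ∷ 3 ∷
    2 ∷ 3 ∷ 0 ∷ 1 ∷ 3 ∷ 0 ∷ 1 ∷ 0 ∷ 1 ∷ 2 ∷ 0 ∷ 1 ∷ 0 ∷ 1 ∷ 2 ∷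
    0 ∷ 1 ∷ 2 ∷ 0 ∷ 1 ∷ 2 ∷ 0 ∷ 1 ∷ 0 ∷ 1 ∷ 2 ∷ 0 ∷ 1 ∷ 0 ∷ 1 ∷ 2 ∷ []

  -- The cycle starts at 48 = 17 + 31, after padding and preperiod.
  cell : ℕ → Fin 64
  cell = class (# 48)

  nextC : Fin 64 → Fin 64
  nextC = next (# 48)

  val : Fin 64 → ℕ
  val = Vec.lookup values

  opaque
    unfolding mex₃

    val-rec : ∀ κ → val (orbit nextC κ 17) ≡
      mex₃ (val (orbit nextC κ 16)) (val (orbit nextC κ 13)) (val (orbit nextC κ 2))
    val-rec = toWitness {a? = Finₚ.all? λ κ → _ ≟ _} tt

  val-early : ∀ (p : Fin 17) → val (cell (toℕ p)) ≡ 9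
  val-early = toWitness {a? = Finₚ.all? λ _ → _ ≟ _} tt

  -- Strong induction with N as the bound: from 17 on, the recurrence refers to the places 1, 4 and
  -- 15 earlier.
  E-value : ∀ N p → p < N → E p ≡ val (cell p)
  E-value (suc N) p (s≤s p≤N) with p <? 17
  ... | yes p<17 = trans (ext-unavailable p<17)
    (trans (sym (val-early (Fin.fromℕ< p<17))) (cong (λ p → val (cell p)) (Finₚ.toℕ-fromℕ< p<17)))
  ... | no p≮17 = subst (λ p → E p ≡ val (cell p)) y≡ (begin
    E (17 + y)                                  ≡⟨ E-rec y ⟩
    mex₃ (E (16 + y)) (E (13 + y)) (E (2 + y))
      ≡⟨ cong₃ mex₃ (earlier 16 (m≤m+n 17 0)) (earlier 13 (m≤m+n 14 3)) (earlier 2 (m≤m+n 3 14)) ⟩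
    mex₃ (val (cell (16 + y))) (val (cell (13 + y))) (val (cell (2 + y)))
      ≡⟨ val-rec (cell y) ⟨
    val (cell (17 + y))                         ∎)
    where
    open ≡-Reasoning
    y = p ∸ 17
    y≡ : 17 + y ≡ p
    y≡ = m+[n∸m]≡n (≮⇒≥ p≮17)
    earlier : ∀ t → t < 17 → E (t + y) ≡ val (cell (t + y))
    earlier t t<17 = E-value N (t + y) (<-≤-trans (subst (t + y <_) y≡ (+-monoˡ-< y t<17)) p≤N)

  g-value : ∀ n → g n ≡ val (cell (17 + n))
  g-value n = trans (sym (E-shift n)) (E-value (18 + n) (17 + n) ≤-refl)

  f : ℕ → ℕ
  f n = val (cell (17 + n))

  cell-periodic : ∀ n → cell (64 + n) ≡ cell (48 + n)
  cell-periodic zero    = refl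
  cell-periodic (suc n) = cong nextC (cell-periodic n)

  periodic : PeriodicFrom f 31 16
  periodic n = cong val (cell-periodic n)

  read : ℕ → ℕ → List ℕ
  read zero    p = []
  read (suc m) p = val (cell p) ∷ read m (suc p)

  read-spells : ∀ m n → Spells f n (read m (17 + n))
  read-spells zero    n = tt
  read-spells (suc m) n = refl , read-spells m (suc n)

  differ : ∀ (q : Fin 16) → toℕ q ≡ 0 ⊎ ∃ λ (n : Fin 16) → val (cell (48 + toℕ n + toℕ q)) ≢ val (cell (48 + toℕ n))
  differ = toWitness {a? = Finₚ.all? λ _ → (_ ≟ _) ⊎-dec Finₚ.any? λ _ → ¬? (_ ≟ _)} tt

  aperiodic : ∀ q → 0 < q → q < 16 → ∃ λ n → f (31 + n + q) ≢ f (31 + n)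
  aperiodic q 0<q q<16 = witness (differ (Fin.fromℕ< q<16))
    where
    q≡ = Finₚ.toℕ-fromℕ< q<16
    witness : (toℕ (Fin.fromℕ< q<16) ≡ 0 ⊎ ∃ λ (n : Fin 16) →
        val (cell (48 + toℕ n + toℕ (Fin.fromℕ< q<16))) ≢ val (cell (48 + toℕ n))) →
      ∃ λ n → f (31 + n + q) ≢ f (31 + n)
    witness (inj₁ q≡0) = ⊥-elim (<⇒≢ 0<q (trans (sym q≡0) q≡))
    witness (inj₂ (n , ≢)) = toℕ n , λ eq → ≢ (trans (cong (λ q → val (cell (48 + toℕ n + q))) q≡) eq)

  ultimatelyPeriodic : UltPeriodic S 16 (nimSequence 2)
  ultimatelyPeriodic =
    -- The 16 table entries from 48 on evaluate to the nim-sequence.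
    ultPeriodic S g-value 31 16 (nimSequence 2) (s≤s z≤n) periodic refl (read-spells 16 31) aperiodic

  -- Classes before the cycle are met only once, so they determine s.
  cell-tail : ∀ s → toℕ (cell s) < 48 → toℕ (cell s) ≡ s
  cell-tail zero    _  = refl
  cell-tail (suc s) lt = let lt′ , eq = back (cell s) lt in trans eq (cong suc (cell-tail s lt′))
    where
    back : ∀ κ → toℕ (nextC κ) < 48 → toℕ κ < 48 × toℕ (nextC κ) ≡ suc (toℕ κ)
    back = toWitness {a? = Finₚ.all? λ _ → (_ ≤? _) →-dec ((_ ≤? _) ×-dec (_ ≟ _))} tt

  -- Apart from the trivial shift 0 and the elements of S, every shift has a coincidence at some n <
  -- 32; thus nothing can be added to S.
  collide : ∀ κ → toℕ κ ∈ (0 ∷ 1 ∷ 4 ∷ 15 ∷ []) × toℕ κ < 48 ⊎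
    ∃ λ (n : Fin 32) → val (orbit nextC κ (17 + toℕ n)) ≡ val (cell (17 + toℕ n))
  collide = toWitness {a? = Finₚ.all? λ _ → ((_ ∈? _) ×-dec (_ ≤? _)) ⊎-dec Finₚ.any? λ _ → _ ≟ _} tt

  InExpansion⇒∈ : ∀ s → InExpansion S s → s ∈ S
  InExpansion⇒∈ s (1≤s , avoids) = conclude (collide (cell s))
    where
    nonzero : s ∈ (0 ∷ S) → s ∈ S
    nonzero (here s≡0)  = ⊥-elim (<⇒≢ 1≤s (sym s≡0))
    nonzero (there s∈S) = s∈S
    conclude : (toℕ (cell s) ∈ (0 ∷ S) × toℕ (cell s) < 48 ⊎
      ∃ λ (n : Fin 32) → val (orbit nextC (cell s) (17 + toℕ n)) ≡ val (cell (17 + toℕ n))) → s ∈ S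
    conclude (inj₁ (∈0S , <48)) = nonzero (subst (_∈ (0 ∷ S)) (cell-tail s <48) ∈0S)
    conclude (inj₂ (n , same))  = ⊥-elim (avoids (toℕ n) (trans (g-value (toℕ n + s))
      (trans (cong val (orbit-+ nextC Fin.zero (17 + toℕ n) s)) (trans same (sym (g-value (toℕ n)))))))

  ∈⇒InExpansion : ∀ s → s ∈ S → InExpansion S s
  ∈⇒InExpansion s s∈S = 1≤s s∈S , G≢option S s∈S (1≤s s∈S)
    where
    1≤s : ∀ {s} → s ∈ S → 1 ≤ s
    1≤s (here refl)                 = s≤s z≤n
    1≤s (there (here refl))         = s≤s z≤n
    1≤s (there (there (here refl))) = s≤s z≤n

  nonExpandable : NonExpandable S 16
  nonExpandable = inj₁ λ s → mk⇔ (InExpansion⇒∈ s) (∈⇒InExpansion s)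

-- Parity of r and choice of the case.

odd-form : ∀ r → ¬ (2 ∣ r) → ∃ λ m → r ≡ 1 + m * 2
odd-form r odd with r divMod 2
... | result m Fin.zero           eq = ⊥-elim (odd (divides m eq))
... | result m (Fin.suc Fin.zero) eq = m , eq

half : ∀ r c → r ≡ 5 + c * 2 → (r + 1) / 2 ≡ 3 + c
half r c r≡ = trans (cong (_/ 2) (trans (+-comm r 1) (cong suc r≡))) (m*n/n≡m (3 + c) 2)

theorem3p16 : (r : ℕ) → 3 ≤ r → ¬ (2 ∣ r) →
    UltPeriodic (1 ∷ (r + 1) ∷ (3 * (r + 1) + r) ∷ []) (4 * (r + 1))
    (rep 2 (rep ((r + 1) / 2 ∸ 1) (0 ∷ 1 ∷ []) ++ (2 ∷ []))
    ++ rep 2 (rep ((r + 1) / 2) (0 ∷ 1 ∷ []) ++ (2 ∷ [])))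
    × (r ≡ 3 → NonExpandable (1 ∷ (r + 1) ∷ (3 * (r + 1) + r) ∷ []) (4 * (r + 1)))
    × (r ≢ 3 → HasExpansion (1 ∷ (r + 1) ∷ (3 * (r + 1) + r) ∷ [])
    (λ s → s ∈ (1 ∷ (r + 1) ∷ (4 * (r + 1) ∸ 1) ∷ [])
    ⊎ Star ((4 * (r + 1) + 1) ∷ (5 * (r + 1)) ∷ []) (4 * (r + 1)) s))
theorem3p16 r 3≤r odd with odd-form r odd
... | 0 , refl with () ← ≤-pred 3≤r
... | 1 , refl =
  FourCoins.ultimatelyPeriodic , (λ _ → FourCoins.nonExpandable) , λ r≢3 → ⊥-elim (r≢3 refl)
-- Here r = 5 + 2c, so a = 6 + 2c as the inflated blocks require.
... | suc (suc c) , r≡ =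
    subst (λ b → UltPeriodic S (4 * (r + 1)) (nimSequence b)) (sym (half r c r≡)) ultimatelyPeriodic
  , (λ r≡3 → ⊥-elim (5+n≢3 (trans (sym r≡) r≡3)))
  -- The theorem lists the third element as 4a - 1, which has to be matched with 3a + r.
  , λ _ → subst (λ ℓ → HasExpansion S
              (λ s → s ∈ (1 ∷ (r + 1) ∷ ℓ ∷ []) ⊎ Star (4 * (r + 1) + 1 ∷ 5 * (r + 1) ∷ []) (4 * (r + 1)) s))
            (cong pred (1+ℓ≡4a r)) hasExpansion
  where
  1+ℓ≡4a : ∀ r → suc (3 * (r + 1) + r) ≡ 4 * (r + 1)
  1+ℓ≡4a = solve-∀
  5+n≢3 : ∀ {n} → 5 + n ≢ 3
  5+n≢3 ()
  open Inflated (r + 1) (3 * (r + 1) + r) c (trans (+-comm r 1) (cong suc r≡)) (1+ℓ≡4a r)
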